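{- Let $(H_i)_{i\in\mathbb N}$ be a sequence of uniform chains of finite rank. Then the infinite uniform chain product $\prod_{i\in\mathbb N}H_i$ is uniform, and its tail satisfies $$\mathrm f\prod_{i\in\mathbb N}H_i\;\cong\;\sum_{i\in\mathbb N}\Bigl(\prod_{k<i}H_k\Bigr)\,\mathrm f H_i .$$
   Context: A chain is a linearly ordered set; $\cong$ is order isomorphism. $A+B$ and $\sum_{i\in I}A_i$ are ordered sums, $AB=\sum_{b\in B}A$ is the anti-lexicographically ordered product (later factors more significant), iterated to finite products $\prod_{k<i}H_k=H_0H_1\cdots H_{i-1}$; the empty product is the one-element chain $1$. $\mathbb N,\mathbb Z$ have their usual orders, $\mathbb N^*$ is $\mathbb N$ with reversed order, $0$ is the empty chain. For a chain $A$ define convex equivalence relations $\rho_n$: $\rho_0$ is equality; $A/n$ is the quotient chain of $\rho_n$-classes $[x]_n$; $x\rho_{n+1}y$ iff the interval between $[x]_n$ and $[y]_n$ in $A/n$ is finite. $A$ has finite rank $n$ if $n$ is least with $A/n\cong1$. $A$ is uniform if $A^{\ge x}=\{y\in A:x\le y\}$ has the same order type for all $x\in A$; then $\mathrm f A$ denotes this common tail. For $x\in A$ put $\mathrm j_xA=\{y\in A:y<x\}$. Every uniform chain $H$ of finite rank $r$ contains an element $x$ (a "canonical zero") such that $\mathrm j_xH\cong B_{r-1}\mathbb N^*+\dots+B_1\mathbb N^*+B_0\mathbb N^*$, where each $B_i$ is either a uniform chain of rank $i$ or the empty chain; the order type of $\mathrm j_xH$ does not depend on the choice of such an $x$. For uniform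 chains $H_i$ ($i\in\mathbb N$) of finite rank, put $P_i=\prod_{k<i}H_k$, choose canonical zeros $x_i\in H_i$ and put $K_i=\mathrm j_{x_i}H_i$. The infinite uniform chain product is defined as $$\prod_{i\in\mathbb N}H_i=\bigl(\cdots+P_2K_2+P_1K_1+P_0K_0\bigr)+\bigl(P_0\,\mathrm f H_0+P_1\,\mathrm f H_1+P_2\,\mathrm f H_2+\cdots\bigr).$$ -}

module Defs where

open import Data.Fin.Base using (Fin; toℕ)
import Data.Fin.Properties as Finₚ
open import Data.List.Base using (List; _∷_; []; _++_)
open import Data.List.Membership.Setoid using (_∈_)
import Data.List.Membership.Setoid.Properties as Memₚ
open import Data.List.Relation.Unary.Any using (here)
open import Data.Nat.Base using (ℕ; zero; suc)
import Data.Nat.Base as ℕ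
import Data.Nat.Properties as ℕₚ
open import Data.Product.Base using (Σ-syntax; _×_; _,_; proj₁)
open import Data.Product.Relation.Binary.Lex.NonStrict using (×-decTotalOrder)
open import Data.Sum.Base using (_⊎_; inj₁; inj₂; [_,_]′)
import Data.Sum.Base as Sum
open import Data.Sum.Relation.Binary.LeftOrder using (⊎-<-decTotalOrder)
import Data.Unit.Polymorphic.Properties as ⊤ₚ
open import Function.Base using (_∘_)
open import Level using (Level; 0ℓ; _⊔_)
import Level
open import Relation.Binary.Bundles using (Setoid; TotalOrder; DecTotalOrder)
import Relation.Binary.Construct.Flip.EqAndOrd as Flip
import Relation.Binary.Construct.NonStrictToStrict as ToStrict
import Relation.Binary.Construct.On as On
open import Relation.Binary.Core using (Rel)
open import Relation.Binary.Definitions using (tri<; tri≈; tri>)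
open import Relation.Binary.Morphism.Structures using (IsOrderIsomorphism)
open import Relation.Binary.PropositionalEquality.Core using (_≡_; refl)
open import Relation.Binary.Structures using (IsStrictTotalOrder)
open import Relation.Nullary.Decidable.Core using (Dec; yes; no)
open import Relation.Nullary.Negation.Core using (¬_)

private
  variable
    a b ℓ : Level

-- Decidability of the order is needed to build lexicographic products;
-- under excluded middle every linear order has it.
Chain : (ℓ : Level) → Set (Level.suc ℓ)
Chain ℓ = DecTotalOrder ℓ ℓ ℓ

∣_∣ : Chain ℓ → Set ℓ
∣ A ∣ = DecTotalOrder.Carrier A

infix 4 _≅ₜ_ _≅_

_≅ₜ_ : TotalOrder a a a → TotalOrder b b b → Set (a ⊔ b)
A ≅ₜ B = Σ[ h ∈ (A.Carrier → B.Carrier) ]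
           IsOrderIsomorphism A._≈_ B._≈_ A._≤_ B._≤_ h
  where
  module A = TotalOrder A
  module B = TotalOrder B

_≅_ : Chain a → Chain b → Set (a ⊔ b)
A ≅ B = DecTotalOrder.totalOrder A ≅ₜ DecTotalOrder.totalOrder B

𝟙 : Chain ℓ
𝟙 {ℓ} = ⊤ₚ.≡-decTotalOrder ℓ

ℕ* : Chain 0ℓ
ℕ* = Flip.decTotalOrder ℕₚ.≤-decTotalOrder

infixl 6 _⊕_
infixl 7 _∙_

_⊕_ : Chain a → Chain b → Chain (a ⊔ b)
_⊕_ = ⊎-<-decTotalOrder

-- The second factor is the more significant one, hence the swap.
_∙_ : Chain a → Chain b → Chain (a ⊔ b)
A ∙ B = ×-decTotalOrder B A

-- The sum of a family of chains along a linear order on a plain set of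
-- indices (propositional equality, so that the family need not respect
-- a coarser equality of indices).
module OrderedSum {I : Set} {_<_ : Rel I 0ℓ} (sto : IsStrictTotalOrder _≡_ _<_)
                  (A : I → Chain ℓ) where

  private
    module I = IsStrictTotalOrder sto
    module A (i : I) = DecTotalOrder (A i)

  Carrier : Set ℓ
  Carrier = Σ[ i ∈ I ] ∣ A i ∣

  infix 4 _≈_ _≤_

  data _≈_ : Rel Carrier ℓ where
    same : ∀ {i x y} → A._≈_ i x y → (i , x) ≈ (i , y)

  data _≤_ : Rel Carrier ℓ where
    earlier : ∀ {i j x y} → i < j → (i , x) ≤ (j , y)
    same    : ∀ {i x y} → A._≤_ i x y → (i , x) ≤ (i , y)

  private
    unsame-≈ : ∀ {i x y} → (i , x) ≈ (i , y) → A._≈_ i x y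
    unsame-≈ (same e) = e

    unsame-≤ : ∀ {i x y} → (i , x) ≤ (i , y) → A._≤_ i x y
    unsame-≤ (earlier i<i) with () ← I.irrefl refl i<i
    unsame-≤ (same p)      = p

    ≤-trans : ∀ {u v w} → u ≤ v → v ≤ w → u ≤ w
    ≤-trans (earlier p) (earlier q) = earlier (I.trans p q)
    ≤-trans (earlier p) (same _)    = earlier p
    ≤-trans (same _)    (earlier q) = earlier q
    ≤-trans (same {i} p) (same q)   = same (A.trans i p q)

    ≤-antisym : ∀ {u v} → u ≤ v → v ≤ u → u ≈ v
    ≤-antisym (earlier p) (earlier q) with () ← I.asym p q
    ≤-antisym (earlier p) (same _)    with () ← I.irrefl refl p
    ≤-antisym (same {i} p) q          = same (A.antisym i p (unsame-≤ q))

    ≤-total : ∀ u v → u ≤ v ⊎ v ≤ u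
    ≤-total (i , x) (j , y) with I.compare i j
    ... | tri< i<j _ _    = inj₁ (earlier i<j)
    ... | tri≈ _ refl _   = Sum.map same same (A.total i x y)
    ... | tri> _ _ j<i    = inj₂ (earlier j<i)

    _≈?_ : ∀ u v → Dec (u ≈ v)
    (i , x) ≈? (j , y) with i I.≟ j
    ... | no  i≢j  = no λ { (same _) → i≢j refl }
    ... | yes refl with A._≟_ i x y
    ...   | yes p  = yes (same p)
    ...   | no ¬p  = no (¬p ∘ unsame-≈)

    _≤?_ : ∀ u v → Dec (u ≤ v)
    (i , x) ≤? (j , y) with I.compare i j
    ... | tri< i<j _ _    = yes (earlier i<j)
    ... | tri> i≮j i≢j _  = no λ { (earlier p) → i≮j p ; (same _) → i≢j refl }
    ... | tri≈ _ refl _ with A._≤?_ i x y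
    ...   | yes p  = yes (same p)
    ...   | no ¬p  = no (¬p ∘ unsame-≤)

  chain : Chain ℓ
  chain = record
    { Carrier = Carrier
    ; _≈_     = _≈_
    ; _≤_     = _≤_
    ; isDecTotalOrder = record
      { isTotalOrder = record
        { isPartialOrder = record
          { isPreorder = record
            { isEquivalence = record
              { refl  = λ { {i , _} → same (A.Eq.refl i) }
              ; sym   = λ { (same {i} p) → same (A.Eq.sym i p) }
              ; trans = λ { (same {i} p) (same q) → same (A.Eq.trans i p q) }
              }
            ; reflexive = λ { (same {i} p) → same (A.reflexive i p) }
            ; trans     = ≤-trans
            }
          ; antisym = ≤-antisym
          }
        ; total = ≤-total
        }
      ; _≟_  = _≈?_
      ; _≤?_ = _≤?_
      }
    }

-- A₀ + A₁ + A₂ + ⋯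
∑ : (ℕ → Chain ℓ) → Chain ℓ
∑ = OrderedSum.chain ℕₚ.<-isStrictTotalOrder

-- ⋯ + A₂ + A₁ + A₀
∑* : (ℕ → Chain ℓ) → Chain ℓ
∑* = OrderedSum.chain (Flip.isStrictTotalOrder ℕₚ.<-isStrictTotalOrder)

-- Aᵣ₋₁ + ⋯ + A₁ + A₀
∑*< : (r : ℕ) → (Fin r → Chain ℓ) → Chain ℓ
∑*< _ = OrderedSum.chain (Flip.isStrictTotalOrder Finₚ.<-isStrictTotalOrder)

-- The quotient of T by the relation "the interval between x and y is
-- finite".  A quotient keeps the carrier and coarsens the equality, so
-- that the elements of a set are counted up to the equality of T.
module Condensation (T : TotalOrder ℓ ℓ ℓ) where

  private
    module T = TotalOrder T
    S : Setoid ℓ ℓ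
    S = T.Eq.setoid

  Between : T.Carrier → T.Carrier → T.Carrier → Set ℓ
  Between x y z = (x T.≤ z × z T.≤ y) ⊎ (y T.≤ z × z T.≤ x)

  -- The list may contain elements outside P; under excluded middle they
  -- can be filtered out.
  Finite : (T.Carrier → Set ℓ) → Set ℓ
  Finite P = Σ[ zs ∈ List T.Carrier ] (∀ {z} → P z → _∈_ S z zs)

  infix 4 _∼_ _≲_

  _∼_ : Rel T.Carrier ℓ
  x ∼ y = Finite (Between x y)

  _≲_ : Rel T.Carrier ℓ
  x ≲ y = x T.≤ y ⊎ x ∼ y

  private
    shrink : ∀ {x y x′ y′} → (∀ {z} → Between x′ y′ z → Between x y z) →
             x ∼ y → x′ ∼ y′
    shrink f (zs , p) = zs , p ∘ f

    ≈⇒∼ : ∀ {x y} → x T.≈ y → x ∼ y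
    ≈⇒∼ {x} x≈y = x ∷ [] , here ∘
      [ (λ (x≤z , z≤y) →
          T.antisym (T.trans z≤y (T.reflexive (T.Eq.sym x≈y))) x≤z)
      , (λ (y≤z , z≤x) → T.antisym z≤x (T.trans (T.reflexive x≈y) y≤z))
      ]′

    ∼-sym : ∀ {x y} → x ∼ y → y ∼ x
    ∼-sym = shrink Sum.swap

    split : ∀ {x y w z} → Between x w z → Between x y z ⊎ Between y w z
    split {y = y} {z = z} b with T.total z y | b
    ... | inj₁ z≤y | inj₁ (x≤z , z≤w) = inj₁ (inj₁ (x≤z , z≤y))
    ... | inj₁ z≤y | inj₂ (w≤z , z≤x) = inj₂ (inj₂ (w≤z , z≤y))
    ... | inj₂ y≤z | inj₁ (x≤z , z≤w) = inj₂ (inj₁ (y≤z , z≤w))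
    ... | inj₂ y≤z | inj₂ (w≤z , z≤x) = inj₁ (inj₂ (y≤z , z≤x))

    ∼-trans : ∀ {x y w} → x ∼ y → y ∼ w → x ∼ w
    ∼-trans (zs , p) (ws , q) = zs ++ ws ,
      [ Memₚ.∈-++⁺ˡ S ∘ p , Memₚ.∈-++⁺ʳ S zs ∘ q ]′ ∘ split

    ≲-trans : ∀ {x y z} → x ≲ y → y ≲ z → x ≲ z
    ≲-trans (inj₁ p) (inj₁ q) = inj₁ (T.trans p q)
    ≲-trans (inj₂ p) (inj₂ q) = inj₂ (∼-trans p q)
    ≲-trans {x} {y} {z} (inj₁ x≤y) (inj₂ y∼z) with T.total x z
    ... | inj₁ x≤z = inj₁ x≤z
    ... | inj₂ z≤x = inj₂ (shrink
      [ (λ (x≤w , w≤z) → inj₂ (T.trans z≤x x≤w , T.trans w≤z (T.trans z≤x x≤y)))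
      , (λ (z≤w , w≤x) → inj₂ (z≤w , T.trans w≤x x≤y)) ]′ y∼z)
    ≲-trans {x} {y} {z} (inj₂ x∼y) (inj₁ y≤z) with T.total x z
    ... | inj₁ x≤z = inj₁ x≤z
    ... | inj₂ z≤x = inj₂ (shrink
      [ (λ (x≤w , w≤z) → inj₂ (T.trans y≤z (T.trans z≤x x≤w) , T.trans w≤z z≤x))
      , (λ (z≤w , w≤x) → inj₂ (T.trans y≤z z≤w , w≤x)) ]′ x∼y)

    ≲-antisym : ∀ {x y} → x ≲ y → y ≲ x → x ∼ y
    ≲-antisym (inj₁ p) (inj₁ q) = ≈⇒∼ (T.antisym p q)
    ≲-antisym (inj₁ _) (inj₂ q) = ∼-sym q
    ≲-antisym (inj₂ p) _        = p

  quotient : TotalOrder ℓ ℓ ℓ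
  quotient = record
    { Carrier = T.Carrier
    ; _≈_     = _∼_
    ; _≤_     = _≲_
    ; isTotalOrder = record
      { isPartialOrder = record
        { isPreorder = record
          { isEquivalence = record
            { refl = ≈⇒∼ T.Eq.refl ; sym = ∼-sym ; trans = ∼-trans }
          ; reflexive = inj₂
          ; trans     = ≲-trans
          }
        ; antisym = ≲-antisym
        }
      ; total = λ x y → Sum.map inj₁ inj₁ (T.total x y)
      }
    }

infixl 7 _/_

-- The equality of A / n is the relation ρₙ.
_/_ : Chain ℓ → ℕ → TotalOrder ℓ ℓ ℓ
A / zero  = DecTotalOrder.totalOrder A
A / suc n = Condensation.quotient (A / n)

CollapsesAt : Chain ℓ → ℕ → Set ℓ
CollapsesAt {ℓ} A n = A / n ≅ₜ DecTotalOrder.totalOrder (𝟙 {ℓ})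

HasRank : Chain ℓ → ℕ → Set ℓ
HasRank A n = CollapsesAt A n × (∀ m → m ℕ.< n → ¬ CollapsesAt A m)

infix 8 _≥_

_≥_ : (A : Chain ℓ) → ∣ A ∣ → Chain ℓ
A ≥ x = On.decTotalOrder A (proj₁ {B = λ y → DecTotalOrder._≤_ A x y})

𝐣 : (A : Chain ℓ) → ∣ A ∣ → Chain ℓ
𝐣 A x = On.decTotalOrder A (proj₁ {B = λ y → y < x})
  where
  open DecTotalOrder A using (_≈_; _≤_)
  open ToStrict _≈_ _≤_ using (_<_)

Uniform : Chain ℓ → Set ℓ
Uniform A = ∀ x y → A ≥ x ≅ A ≥ y

-- The common tail of A is only an order type: it has one representative
-- for each element of A, and uniformity says that they are isomorphic.
𝐟 : (A : Chain ℓ) → Uniform A → ∣ A ∣ → Chain ℓ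
𝐟 A _ x = A ≥ x

CanonicalZero : (A : Chain ℓ) → ℕ → ∣ A ∣ → Set (Level.suc ℓ)
CanonicalZero {ℓ} A r x =
  Σ[ B ∈ (Fin r → Chain ℓ) ]
    (∀ i → (Uniform (B i) × HasRank (B i) (toℕ i)) ⊎ ¬ ∣ B i ∣) ×
    𝐣 A x ≅ ∑*< r (λ i → B i ∙ ℕ*)

-- H₀ H₁ ⋯ Hᵢ₋₁
∏< : (ℕ → Chain ℓ) → ℕ → Chain ℓ
∏< H zero    = 𝟙
∏< H (suc i) = ∏< H i ∙ H i

-- This is the infinite uniform chain product when every x i is a
-- canonical zero of H i.
∏∞ : (H : ℕ → Chain ℓ) → (∀ i → Uniform (H i)) → (∀ i → ∣ H i ∣) → Chain ℓ
∏∞ H unif x = ∑* (λ i → ∏< H i ∙ 𝐣 (H i) (x i))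
            ⊕ ∑  (λ i → ∏< H i ∙ 𝐟 (H i) (unif i) (x i))

{-# OPTIONS --safe #-}
module Submission where

-- Write Pᵢ = H₀⋯Hᵢ₋₁, and let Gᵢ consist of the elements of Hᵢ strictly above
-- xᵢ, so that f Hᵢ = 1 + Gᵢ.  Put Sᵢ = Pᵢ f Hᵢ + Pᵢ₊₁ f Hᵢ₊₁ + ⋯.  Every
-- closed final segment of the product is shown to be isomorphic to S₀.
--
-- Finite rank enters once (uniform-dichotomy): if some element of Hᵢ has an
-- immediate successor, then by uniformity so does xᵢ, and Gᵢ ≅ f Hᵢ.
-- Otherwise a finite interval of Hᵢ has one point only, so that all the
-- condensations ρₙ are the equality and Hᵢ, being of finite rank, is a point.
-- In the first case Pᵢ + Pᵢ f Hᵢ ≅ Pᵢ (1 + Gᵢ) = Pᵢ f Hᵢ; in the second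
-- Pᵢ f Hᵢ ≅ Pᵢ ≅ Pᵢ₊₁.  It follows that Pᵢ + Sᵢ ≅ Sᵢ (absorb): the next
-- factor that is not a point absorbs Pᵢ, and if there is none then Sᵢ is
-- Pᵢ + Pᵢ + ⋯.  In both cases also Pᵢ Gᵢ + Sᵢ₊₁ ≅ Sᵢ (S-suc).
--
-- As Pᵢ₊₁ = Pᵢ Hᵢ, the segment of Pᵢ₊₁ above (p , h) is the segment of Pᵢ
-- above p followed by Pᵢ times what is strictly above h, a copy of Pᵢ Gᵢ.
-- By induction on i, the segment of Pᵢ above any p, followed by Sᵢ, is
-- isomorphic to S₀ (P-tail).
--
-- A point of the positive half lies in some Pᵢ f Hᵢ, and the segment above it
-- is a closed final segment of Pᵢ₊₁ followed by Sᵢ₊₁.  A point of the negative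
-- half lies in some Pᵢ Kᵢ.  Since Hᵢ = Kᵢ + 1 + Gᵢ, one has
-- Pᵢ Kᵢ + (Pᵢ + Sᵢ) ≅ Pᵢ₊₁ + Sᵢ₊₁ (glue), so that everything from the summand
-- Pᵢ Kᵢ on is isomorphic to Pᵢ₊₁ + Sᵢ₊₁, and the given point corresponds to
-- one of Pᵢ₊₁.  P-tail applies in both cases.

open import Axiom.ExcludedMiddle using (ExcludedMiddle)
open import Data.Empty using (⊥-elim)
open import Data.List.Base using (List; []; _∷_)
open import Data.List.Membership.Setoid using (_∈_)
open import Data.List.Relation.Unary.Any using (here; there)
open import Data.Nat.Base using (ℕ; zero; suc; s≤s; z≤n)
open import Data.Product.Base using (Σ-syntax; _×_; _,_; proj₁; proj₂)
open import Data.Sum.Base using (_⊎_; inj₁; inj₂)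
import Data.Sum.Base as Sum
open import Data.Sum.Relation.Binary.LeftOrder using (₁∼₂; ₁∼₁; ₂∼₂)
open import Data.Sum.Relation.Binary.Pointwise using (inj₁; inj₂)
open import Data.Unit.Polymorphic.Base using (tt)
open import Function.Base using (_∘_; id)
open import Level using (Level)
import Level
open import Relation.Binary.Bundles using (Setoid; TotalOrder; DecTotalOrder)
import Relation.Binary.Construct.On as On
import Relation.Binary.Construct.NonStrictToStrict as ToStrict
open import Relation.Binary.PropositionalEquality.Core using (refl)
open import Relation.Binary.Morphism.Structures using (IsOrderIsomorphism)
import Relation.Binary.Reasoning.Setoid as SetoidReasoning
open import Relation.Nullary.Decidable.Core using (Dec; yes; no)
open import Relation.Nullary.Negation.Core using (¬_)
open import Defs

private
  variable
    ℓ : Level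

-- Order isomorphisms as pairs of inverse monotone maps

-- Order isomorphism, given by two mutually inverse monotone maps.  Unlike
-- _≅_, which unfolds, this record type determines the two chains, so that
-- they can stay implicit.
infix 4 _≃_

record _≃_ (A B : Chain ℓ) : Set ℓ where
  private
    module A = DecTotalOrder A
    module B = DecTotalOrder B
  field
    to        : ∣ A ∣ → ∣ B ∣
    from      : ∣ B ∣ → ∣ A ∣
    to-mono   : ∀ {x y} → x A.≤ y → to x B.≤ to y
    from-mono : ∀ {x y} → x B.≤ y → from x A.≤ from y
    to∘from   : ∀ y → to (from y) B.≈ y
    from∘to   : ∀ x → from (to x) A.≈ x

  to-cong : ∀ {x y} → x A.≈ y → to x B.≈ to y
  to-cong e = B.antisym (to-mono (A.reflexive e)) (to-mono (A.reflexive (A.Eq.sym e)))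

open _≃_

≃-refl : {A : Chain ℓ} → A ≃ A
≃-refl {A = A} = record
  { to = id ; from = id ; to-mono = id ; from-mono = id
  ; to∘from = λ _ → A.Eq.refl ; from∘to = λ _ → A.Eq.refl }
  where module A = DecTotalOrder A

≃-sym : {A B : Chain ℓ} → A ≃ B → B ≃ A
≃-sym φ = record
  { to = from φ ; from = to φ ; to-mono = from-mono φ ; from-mono = to-mono φ
  ; to∘from = from∘to φ ; from∘to = to∘from φ }

≃-trans : {A B C : Chain ℓ} → A ≃ B → B ≃ C → A ≃ C
≃-trans {A = A} {C = C} φ ψ = record
  { to = to ψ ∘ to φ ; from = from φ ∘ from ψ
  ; to-mono = to-mono ψ ∘ to-mono φ ; from-mono = from-mono φ ∘ from-mono ψ
  ; to∘from = λ z → C.Eq.trans (to-cong ψ (to∘from φ (from ψ z))) (to∘from ψ z)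
  ; from∘to = λ x → A.Eq.trans (to-cong (≃-sym φ) (from∘to ψ (to φ x))) (from∘to φ x) }
  where
  module A = DecTotalOrder A
  module C = DecTotalOrder C

≃-setoid : (ℓ : Level) → Setoid (Level.suc ℓ) ℓ
≃-setoid ℓ = record
  { Carrier = Chain ℓ ; _≈_ = _≃_
  ; isEquivalence = record { refl = ≃-refl ; sym = ≃-sym ; trans = ≃-trans } }

module ≃-Reasoning {ℓ} = SetoidReasoning (≃-setoid ℓ)

≃⇒≅ : {A B : Chain ℓ} → A ≃ B → A ≅ B
≃⇒≅ {A = A} {B} φ = to φ , record
  { isOrderMonomorphism = record
    { isOrderHomomorphism = record { cong = to-cong φ ; mono = to-mono φ }
    ; injective = λ {x} {y} e →
        A.Eq.trans (A.Eq.sym (from∘to φ x)) (A.Eq.trans (to-cong (≃-sym φ) e) (from∘to φ y))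
    ; cancel = λ {x} {y} p →
        A.trans (A.reflexive (A.Eq.sym (from∘to φ x)))
                (A.trans (from-mono φ p) (A.reflexive (from∘to φ y)))
    }
  ; surjective = λ y → from φ y , λ e → B.Eq.trans (to-cong φ e) (to∘from φ y)
  }
  where
  module A = DecTotalOrder A
  module B = DecTotalOrder B

≅⇒≃ : {A B : Chain ℓ} → A ≅ B → A ≃ B
≅⇒≃ {A = A} {B} (h , iso) = record
  { to = h ; from = g ; to-mono = mono
  ; from-mono = λ {x} {y} p → cancel
      (B.trans (B.reflexive (hg x)) (B.trans p (B.reflexive (B.Eq.sym (hg y)))))
  ; to∘from = hg
  ; from∘to = λ x → injective (hg (h x)) }
  where
  module A = DecTotalOrder A
  module B = DecTotalOrder B
  open IsOrderIsomorphism iso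
  g  = λ y → proj₁ (surjective y)
  hg : ∀ y → h (g y) B.≈ y
  hg y = proj₂ (surjective y) A.Eq.refl

-- Between linear orders a monotone injection with a right inverse is an
-- isomorphism: the right inverse is automatically monotone.
mono⇒≃ : {A B : Chain ℓ} →
         let module A = DecTotalOrder A; module B = DecTotalOrder B in
         (f : ∣ A ∣ → ∣ B ∣) (g : ∣ B ∣ → ∣ A ∣) →
         (∀ {x y} → x A.≤ y → f x B.≤ f y) →
         (∀ {x y} → f x B.≈ f y → x A.≈ y) →
         (∀ y → f (g y) B.≈ y) → A ≃ B
mono⇒≃ {A = A} {B} f g f-mono f-inj fg = record
  { to = f ; from = g ; to-mono = f-mono ; from-mono = g-mono
  ; to∘from = fg ; from∘to = λ x → f-inj (fg (f x)) }
  where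
  module A = DecTotalOrder A
  module B = DecTotalOrder B
  g-mono : ∀ {x y} → x B.≤ y → g x A.≤ g y
  g-mono {x} {y} p with A.total (g x) (g y)
  ... | inj₁ q = q
  ... | inj₂ q = A.reflexive (f-inj (B.Eq.trans (fg x) (B.Eq.trans
        (B.antisym p (B.trans (B.reflexive (B.Eq.sym (fg y)))
                     (B.trans (f-mono q) (B.reflexive (fg x)))))
        (B.Eq.sym (fg y)))))

-- Final segments

infix 8 _≻_

-- The elements strictly above x.
_≻_ : (A : Chain ℓ) → ∣ A ∣ → Chain ℓ
A ≻ x = On.decTotalOrder A (proj₁ {B = λ y → x < y})
  where
  open DecTotalOrder A using (_≈_; _≤_)
  open ToStrict _≈_ _≤_ using (_<_)

-- An isomorphism restricts to final segments.  The base point of the second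
-- one is the computed image of x, which is what lets a chain of isomorphisms
-- keep track of a point.
≥-cong : {A B : Chain ℓ} (φ : A ≃ B) (x : ∣ A ∣) → A ≥ x ≃ B ≥ to φ x
≥-cong {A = A} φ x = record
  { to        = λ (y , p) → to φ y , to-mono φ p
  ; from      = λ (z , p) →
      from φ z , A.trans (A.reflexive (A.Eq.sym (from∘to φ x))) (from-mono φ p)
  ; to-mono   = to-mono φ
  ; from-mono = from-mono φ
  ; to∘from   = λ (z , _) → to∘from φ z
  ; from∘to   = λ (y , _) → from∘to φ y }
  where module A = DecTotalOrder A

-- An isomorphism of closed final segments matches their least elements,
-- hence what lies above these.
≥⇒≻ : (A B : Chain ℓ) (x : ∣ A ∣) (y : ∣ B ∣) → A ≥ x ≃ B ≥ y → A ≻ x ≃ B ≻ y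
≥⇒≻ {ℓ} A B x y φ = record
  { to        = restrict A B x y φ
  ; from      = restrict B A y x (≃-sym φ)
  ; to-mono   = to-mono φ
  ; from-mono = from-mono φ
  ; to∘from   = retract B A y x (≃-sym φ)
  ; from∘to   = retract A B x y φ }
  where
  module _ (A B : Chain ℓ) (x : ∣ A ∣) (y : ∣ B ∣) (φ : A ≥ x ≃ B ≥ y) where
    private
      module A = DecTotalOrder A
      module B = DecTotalOrder B
    restrict : ∣ A ≻ x ∣ → ∣ B ≻ y ∣
    restrict (u , x≤u , x≉u) =
      proj₁ v , proj₂ v , λ y≈v → x≉u (A.antisym x≤u (u≤x y≈v))
      where
      v = to φ (u , x≤u)
      u≤x : y B.≈ proj₁ v → u A.≤ x
      u≤x y≈v = A.trans (A.reflexive (A.Eq.sym (from∘to φ (u , x≤u)))) (A.trans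
        (from-mono φ {y = to φ (x , A.refl)} (B.trans
          (B.reflexive (B.Eq.sym y≈v)) (proj₂ (to φ (x , A.refl)))))
        (A.reflexive (from∘to φ (x , A.refl))))
  retract : (A B : Chain ℓ) (x : ∣ A ∣) (y : ∣ B ∣) (φ : A ≥ x ≃ B ≥ y) (u : ∣ A ≻ x ∣) →
            DecTotalOrder._≈_ A
              (proj₁ (restrict B A y x (≃-sym φ) (restrict A B x y φ u))) (proj₁ u)
  retract A B x y φ (u , x≤u , _) = from∘to φ (u , x≤u)

-- Sums and products of two chains

⊕-cong : {A A′ B B′ : Chain ℓ} → A ≃ A′ → B ≃ B′ → A ⊕ B ≃ A′ ⊕ B′
⊕-cong φ ψ = record
  { to        = Sum.map (to φ) (to ψ)
  ; from      = Sum.map (from φ) (from ψ)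
  ; to-mono   = λ { ₁∼₂ → ₁∼₂ ; (₁∼₁ p) → ₁∼₁ (to-mono φ p) ; (₂∼₂ p) → ₂∼₂ (to-mono ψ p) }
  ; from-mono = λ { ₁∼₂ → ₁∼₂ ; (₁∼₁ p) → ₁∼₁ (from-mono φ p) ; (₂∼₂ p) → ₂∼₂ (from-mono ψ p) }
  ; to∘from   = λ { (inj₁ x) → inj₁ (to∘from φ x) ; (inj₂ y) → inj₂ (to∘from ψ y) }
  ; from∘to   = λ { (inj₁ x) → inj₁ (from∘to φ x) ; (inj₂ y) → inj₂ (from∘to ψ y) } }

⊕-assoc : (A B C : Chain ℓ) → A ⊕ B ⊕ C ≃ A ⊕ (B ⊕ C)
⊕-assoc A B C = record
  { to        = Sum.assocʳ
  ; from      = Sum.assocˡ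
  ; to-mono   = λ { {inj₁ (inj₁ _)} ₁∼₂ → ₁∼₂ ; {inj₁ (inj₂ _)} ₁∼₂ → ₂∼₂ ₁∼₂
                  ; (₁∼₁ ₁∼₂) → ₁∼₂ ; (₁∼₁ (₁∼₁ p)) → ₁∼₁ p ; (₁∼₁ (₂∼₂ p)) → ₂∼₂ (₁∼₁ p)
                  ; (₂∼₂ p) → ₂∼₂ (₂∼₂ p) }
  ; from-mono = λ { {y = inj₂ (inj₁ _)} ₁∼₂ → ₁∼₁ ₁∼₂ ; {y = inj₂ (inj₂ _)} ₁∼₂ → ₁∼₂
                  ; (₁∼₁ p) → ₁∼₁ (₁∼₁ p) ; (₂∼₂ ₁∼₂) → ₁∼₂
                  ; (₂∼₂ (₁∼₁ p)) → ₁∼₁ (₂∼₂ p) ; (₂∼₂ (₂∼₂ p)) → ₂∼₂ p }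
  ; to∘from   = λ { (inj₁ _) → inj₁ A.Eq.refl ; (inj₂ (inj₁ _)) → inj₂ (inj₁ B.Eq.refl)
                  ; (inj₂ (inj₂ _)) → inj₂ (inj₂ C.Eq.refl) }
  ; from∘to   = λ { (inj₁ (inj₁ _)) → inj₁ (inj₁ A.Eq.refl)
                  ; (inj₁ (inj₂ _)) → inj₁ (inj₂ B.Eq.refl) ; (inj₂ _) → inj₂ C.Eq.refl } }
  where
  module A = DecTotalOrder A
  module B = DecTotalOrder B
  module C = DecTotalOrder C

⊕-≥₁ : (A B : Chain ℓ) (x : ∣ A ∣) → (A ⊕ B) ≥ inj₁ x ≃ (A ≥ x) ⊕ B
⊕-≥₁ A B x = record
  { to        = λ { (inj₁ y , ₁∼₁ p) → inj₁ (y , p) ; (inj₂ z , _) → inj₂ z }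
  ; from      = λ { (inj₁ (y , p)) → inj₁ y , ₁∼₁ p ; (inj₂ z) → inj₂ z , ₁∼₂ }
  ; to-mono   = λ { {_ , ₁∼₁ _} {_ , ₁∼₁ _} (₁∼₁ p) → ₁∼₁ p
                  ; {_ , ₁∼₁ _} {_ , ₁∼₂} ₁∼₂ → ₁∼₂ ; {_ , ₁∼₂} {_ , ₁∼₂} (₂∼₂ p) → ₂∼₂ p }
  ; from-mono = λ { ₁∼₂ → ₁∼₂ ; (₁∼₁ p) → ₁∼₁ p ; (₂∼₂ p) → ₂∼₂ p }
  ; to∘from   = λ { (inj₁ _) → inj₁ A.Eq.refl ; (inj₂ _) → inj₂ B.Eq.refl }
  ; from∘to   = λ { (inj₁ _ , ₁∼₁ _) → inj₁ A.Eq.refl ; (inj₂ _ , ₁∼₂) → inj₂ B.Eq.refl } }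
  where
  module A = DecTotalOrder A
  module B = DecTotalOrder B

⊕-≥₂ : (A B : Chain ℓ) (x : ∣ B ∣) → (A ⊕ B) ≥ inj₂ x ≃ B ≥ x
⊕-≥₂ A B x = record
  { to        = λ { (inj₂ z , ₂∼₂ p) → z , p }
  ; from      = λ { (z , p) → inj₂ z , ₂∼₂ p }
  ; to-mono   = λ { {_ , ₂∼₂ _} {_ , ₂∼₂ _} (₂∼₂ p) → p }
  ; from-mono = ₂∼₂
  ; to∘from   = λ _ → B.Eq.refl
  ; from∘to   = λ { (inj₂ _ , ₂∼₂ _) → inj₂ B.Eq.refl } }
  where module B = DecTotalOrder B

∙-cong : (A : Chain ℓ) {B B′ : Chain ℓ} → B ≃ B′ → A ∙ B ≃ A ∙ B′
∙-cong {ℓ} A {B} {B′} φ = record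
  { to        = λ (b , a) → to φ b , a
  ; from      = λ (b , a) → from φ b , a
  ; to-mono   = mono φ
  ; from-mono = mono (≃-sym φ)
  ; to∘from   = λ (b , a) → to∘from φ b , A.Eq.refl
  ; from∘to   = λ (b , a) → from∘to φ b , A.Eq.refl }
  where
  module A = DecTotalOrder A
  mono : {B B′ : Chain ℓ} (φ : B ≃ B′) {u v : ∣ A ∙ B ∣} →
         DecTotalOrder._≤_ (A ∙ B) u v →
         DecTotalOrder._≤_ (A ∙ B′) (to φ (proj₁ u) , proj₂ u) (to φ (proj₁ v) , proj₂ v)
  mono {B} φ {b , _} {b′ , _} (inj₁ (p , b≉b′)) = inj₁ (to-mono φ p , λ e → b≉b′
    (B.Eq.trans (B.Eq.sym (from∘to φ b)) (B.Eq.trans (to-cong (≃-sym φ) e) (from∘to φ b′))))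
    where module B = DecTotalOrder B
  mono φ (inj₂ (e , p)) = inj₂ (to-cong φ e , p)

∙-distrib-⊕ : (A B C : Chain ℓ) → A ∙ (B ⊕ C) ≃ A ∙ B ⊕ A ∙ C
∙-distrib-⊕ A B C = ≃-sym (mono⇒≃
  (λ { (inj₁ (b , a)) → inj₁ b , a ; (inj₂ (c , a)) → inj₂ c , a })
  (λ { (inj₁ b , a) → inj₁ (b , a) ; (inj₂ c , a) → inj₂ (c , a) })
  (λ { {inj₁ _} {inj₂ _} ₁∼₂ → inj₁ (₁∼₂ , λ ())
     ; (₁∼₁ (inj₁ (p , n))) → inj₁ (₁∼₁ p , λ { (inj₁ e) → n e })
     ; (₁∼₁ (inj₂ (e , p))) → inj₂ (inj₁ e , p)
     ; (₂∼₂ (inj₁ (p , n))) → inj₁ (₂∼₂ p , λ { (inj₂ e) → n e })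
     ; (₂∼₂ (inj₂ (e , p))) → inj₂ (inj₂ e , p) })
  (λ { {inj₁ _} {inj₁ _} (inj₁ e , e′) → inj₁ (e , e′)
     ; {inj₂ _} {inj₂ _} (inj₂ e , e′) → inj₂ (e , e′) })
  (λ { (inj₁ _ , _) → inj₁ B.Eq.refl , A.Eq.refl
     ; (inj₂ _ , _) → inj₂ C.Eq.refl , A.Eq.refl }))
  where
  module A = DecTotalOrder A
  module B = DecTotalOrder B
  module C = DecTotalOrder C

-- At most one element, up to the equality of the chain.
Trivial : Chain ℓ → Set ℓ
Trivial A = ∀ x y → DecTotalOrder._≈_ A x y

∙-trivial : (A B : Chain ℓ) → Trivial B → ∣ B ∣ → A ∙ B ≃ A
∙-trivial A B triv b = record
  { to        = proj₂
  ; from      = b ,_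
  ; to-mono   = λ { (inj₁ (_ , n)) → ⊥-elim (n (triv _ _)) ; (inj₂ (_ , p)) → p }
  ; from-mono = λ p → inj₂ (triv b b , p)
  ; to∘from   = λ _ → A.Eq.refl
  ; from∘to   = λ (b′ , _) → triv b b′ , A.Eq.refl }
  where module A = DecTotalOrder A

-- Cutting a chain at an element

cut-≥ : (A : Chain ℓ) (x : ∣ A ∣) → A ≥ x ≃ 𝟙 {ℓ} ⊕ (A ≻ x)
cut-≥ {ℓ} A x = ≃-sym (mono⇒≃
  join
  (λ y → split y (x A.≟ proj₁ y))
  (λ { {inj₁ _} {inj₂ (_ , p , _)} ₁∼₂ → p ; (₁∼₁ _) → A.refl ; (₂∼₂ p) → p })
  (λ { {inj₁ _} {inj₁ _} _ → inj₁ refl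
     ; {inj₁ _} {inj₂ (_ , _ , x≉y)} e → ⊥-elim (x≉y e)
     ; {inj₂ (_ , _ , x≉y)} {inj₁ _} e → ⊥-elim (x≉y (A.Eq.sym e))
     ; {inj₂ _} {inj₂ _} e → inj₂ e })
  (λ y → join-split y (x A.≟ proj₁ y)))
  where
  module A = DecTotalOrder A
  join : ∣ 𝟙 {ℓ} ⊕ (A ≻ x) ∣ → ∣ A ≥ x ∣
  join (inj₁ _)           = x , A.refl
  join (inj₂ (y , p , _)) = y , p
  split : (y : ∣ A ≥ x ∣) → Dec (x A.≈ proj₁ y) → ∣ 𝟙 {ℓ} ⊕ (A ≻ x) ∣
  split _       (yes _)  = inj₁ tt
  split (y , p) (no x≉y) = inj₂ (y , p , x≉y)
  join-split : ∀ y d → proj₁ (join (split y d)) A.≈ proj₁ y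
  join-split _ (yes e) = e
  join-split _ (no _)  = A.Eq.refl

cut-𝐣 : (A : Chain ℓ) (x : ∣ A ∣) → A ≃ 𝐣 A x ⊕ (A ≥ x)
cut-𝐣 A x = ≃-sym (mono⇒≃
  join
  (λ y → split y (x A.≤? y))
  (λ { {inj₁ (_ , y≤x , _)} {inj₂ (_ , x≤z)} ₁∼₂ → A.trans y≤x x≤z
     ; (₁∼₁ p) → p ; (₂∼₂ p) → p })
  (λ { {inj₁ _} {inj₁ _} e → inj₁ e
     ; {inj₁ (_ , p , y≉x)} {inj₂ (_ , q)} e →
         ⊥-elim (y≉x (A.antisym p (A.trans q (A.reflexive (A.Eq.sym e)))))
     ; {inj₂ (_ , q)} {inj₁ (_ , p , y≉x)} e →
         ⊥-elim (y≉x (A.antisym p (A.trans q (A.reflexive e))))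
     ; {inj₂ _} {inj₂ _} e → inj₂ e })
  (λ y → join-split y (x A.≤? y)))
  where
  module A = DecTotalOrder A
  join : ∣ 𝐣 A x ⊕ (A ≥ x) ∣ → ∣ A ∣
  join (inj₁ (y , _)) = y
  join (inj₂ (y , _)) = y
  split : ∀ y → Dec (x A.≤ y) → ∣ 𝐣 A x ⊕ (A ≥ x) ∣
  split y (yes p) = inj₂ (y , p)
  split y (no x≰y) with A.total y x
  ... | inj₁ p = inj₁ (y , p , λ e → x≰y (A.reflexive (A.Eq.sym e)))
  ... | inj₂ q = ⊥-elim (x≰y q)
  join-split : ∀ y d → join (split y d) A.≈ y
  join-split y (yes _) = A.Eq.refl
  join-split y (no x≰y) with A.total y x
  ... | inj₁ _ = A.Eq.refl
  ... | inj₂ q = ⊥-elim (x≰y q)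

∙-cut-≥ : (A B : Chain ℓ) (b : ∣ B ∣) → A ∙ (B ≥ b) ≃ A ⊕ A ∙ (B ≻ b)
∙-cut-≥ {ℓ} A B b = begin
  A ∙ (B ≥ b)              ≈⟨ ∙-cong A (cut-≥ B b) ⟩
  A ∙ (𝟙 ⊕ (B ≻ b))        ≈⟨ ∙-distrib-⊕ A (𝟙 {ℓ}) (B ≻ b) ⟩
  A ∙ 𝟙 ⊕ A ∙ (B ≻ b)      ≈⟨ ⊕-cong (∙-trivial A (𝟙 {ℓ}) (λ _ _ → refl) tt) ≃-refl ⟩
  A ⊕ A ∙ (B ≻ b)          ∎
  where open ≃-Reasoning

∙-cut : (A B : Chain ℓ) (b : ∣ B ∣) → A ∙ 𝐣 B b ⊕ (A ⊕ A ∙ (B ≻ b)) ≃ A ∙ B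
∙-cut A B b = begin
  A ∙ 𝐣 B b ⊕ (A ⊕ A ∙ (B ≻ b))  ≈⟨ ⊕-cong ≃-refl (∙-cut-≥ A B b) ⟨
  A ∙ 𝐣 B b ⊕ A ∙ (B ≥ b)        ≈⟨ ∙-distrib-⊕ A (𝐣 B b) (B ≥ b) ⟨
  A ∙ (𝐣 B b ⊕ (B ≥ b))          ≈⟨ ∙-cong A (cut-𝐣 B b) ⟨
  A ∙ B                          ∎
  where open ≃-Reasoning

-- The segment of a product above (b , a): the rest of the copy of A at b, and
-- then the copies of A at the larger elements of B.
∙-≥ : (A B : Chain ℓ) (b : ∣ B ∣) (a : ∣ A ∣) →
      (A ∙ B) ≥ (b , a) ≃ (A ≥ a) ⊕ A ∙ (B ≻ b)
∙-≥ A B b a = begin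
  (A ∙ B) ≥ (b , a)
    ≈⟨ ≥-cong (∙-cut A B b) (inj₂ (inj₁ a)) ⟨
  (A ∙ 𝐣 B b ⊕ (A ⊕ A ∙ (B ≻ b))) ≥ inj₂ (inj₁ a)
    ≈⟨ ⊕-≥₂ (A ∙ 𝐣 B b) (A ⊕ A ∙ (B ≻ b)) (inj₁ a) ⟩
  (A ⊕ A ∙ (B ≻ b)) ≥ inj₁ a
    ≈⟨ ⊕-≥₁ A (A ∙ (B ≻ b)) a ⟩
  (A ≥ a) ⊕ A ∙ (B ≻ b) ∎
  where open ≃-Reasoning

-- Restricting the more significant factor to a final segment does not change
-- what lies above one of the remaining elements.
∙-≥-≥ : (A B : Chain ℓ) (b : ∣ B ∣) (y : ∣ B ≥ b ∣) (a : ∣ A ∣) →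
        (A ∙ (B ≥ b)) ≥ (y , a) ≃ (A ∙ B) ≥ (proj₁ y , a)
∙-≥-≥ A B b (y , b≤y) a = record
  { to        = λ (((z , _) , c) , p) → (z , c) , p
  ; from      = λ { ((z , c) , p@(inj₁ (y≤z , _))) → ((z , B.trans b≤y y≤z) , c) , p
                  ; ((z , c) , p@(inj₂ (e , _))) →
                      ((z , B.trans b≤y (B.reflexive e)) , c) , p }
  ; to-mono   = id
  ; from-mono = λ { {_ , inj₁ _} {_ , inj₁ _} p → p ; {_ , inj₁ _} {_ , inj₂ _} p → p
                  ; {_ , inj₂ _} {_ , inj₁ _} p → p ; {_ , inj₂ _} {_ , inj₂ _} p → p }
  ; to∘from   = λ { (_ , inj₁ _) → AB.Eq.refl ; (_ , inj₂ _) → AB.Eq.refl }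
  ; from∘to   = λ { (_ , inj₁ _) → AB.Eq.refl ; (_ , inj₂ _) → AB.Eq.refl } }
  where
  module B = DecTotalOrder B
  module AB = DecTotalOrder (A ∙ B)

-- Infinite sums

∑-cong : (f g : ℕ → Chain ℓ) → (∀ i → f i ≃ g i) → ∑ f ≃ ∑ g
∑-cong f g φ = record
  { to        = λ (i , a) → i , to (φ i) a
  ; from      = λ (i , a) → i , from (φ i) a
  ; to-mono   = λ { (earlier p) → earlier p ; (same {i} p) → same (to-mono (φ i) p) }
  ; from-mono = λ { (earlier p) → earlier p ; (same {i} p) → same (from-mono (φ i) p) }
  ; to∘from   = λ (i , a) → same (to∘from (φ i) a)
  ; from∘to   = λ (i , a) → same (from∘to (φ i) a) }
  where open OrderedSum using (earlier; same)

∑-suc : (f : ℕ → Chain ℓ) → ∑ f ≃ f 0 ⊕ ∑ (f ∘ suc)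
∑-suc f = ≃-sym (mono⇒≃
  (λ { (inj₁ a) → 0 , a ; (inj₂ (i , a)) → suc i , a })
  (λ { (zero , a) → inj₁ a ; (suc i , a) → inj₂ (i , a) })
  (λ { {inj₁ _} {inj₂ _} ₁∼₂ → earlier (s≤s z≤n) ; (₁∼₁ p) → same p
     ; (₂∼₂ (earlier p)) → earlier (s≤s p) ; (₂∼₂ (same p)) → same p })
  (λ { {inj₁ _} {inj₁ _} (same e) → inj₁ e ; {inj₂ _} {inj₂ _} (same e) → inj₂ (same e) })
  (λ { (zero , a) → ∑.Eq.refl ; (suc i , a) → ∑.Eq.refl }))
  where
  open OrderedSum using (earlier; same)
  module ∑ = DecTotalOrder (∑ f)

∑*-suc : (g : ℕ → Chain ℓ) → ∑* g ≃ ∑* (g ∘ suc) ⊕ g 0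
∑*-suc g = ≃-sym (mono⇒≃
  (λ { (inj₁ (i , a)) → suc i , a ; (inj₂ a) → 0 , a })
  (λ { (zero , a) → inj₂ a ; (suc i , a) → inj₁ (i , a) })
  (λ { {inj₁ _} {inj₂ _} ₁∼₂ → earlier (s≤s z≤n) ; (₂∼₂ p) → same p
     ; (₁∼₁ (earlier p)) → earlier (s≤s p) ; (₁∼₁ (same p)) → same p })
  (λ { {inj₂ _} {inj₂ _} (same e) → inj₂ e ; {inj₁ _} {inj₁ _} (same e) → inj₁ (same e) })
  (λ { (zero , a) → ∑*.Eq.refl ; (suc i , a) → ∑*.Eq.refl }))
  where
  open OrderedSum using (earlier; same)
  module ∑* = DecTotalOrder (∑* g)

-- fᵢ + fᵢ₊₁ + fᵢ₊₂ + ⋯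
∑≥ : ℕ → (ℕ → Chain ℓ) → Chain ℓ
∑≥ zero    f = ∑ f
∑≥ (suc i) f = ∑≥ i (f ∘ suc)

∑≥-suc : ∀ i (f : ℕ → Chain ℓ) → ∑≥ i f ≃ f i ⊕ ∑≥ (suc i) f
∑≥-suc zero    f = ∑-suc f
∑≥-suc (suc i) f = ∑≥-suc i (f ∘ suc)

∑-≥ : (f : ℕ → Chain ℓ) (i : ℕ) (a : ∣ f i ∣) →
      ∑ f ≥ (i , a) ≃ (f i ≥ a) ⊕ ∑≥ (suc i) f
∑-≥ f zero a = begin
  ∑ f ≥ (0 , a)                     ≈⟨ ≥-cong (∑-suc f) (0 , a) ⟩
  (f 0 ⊕ ∑ (f ∘ suc)) ≥ inj₁ a      ≈⟨ ⊕-≥₁ (f 0) (∑ (f ∘ suc)) a ⟩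
  (f 0 ≥ a) ⊕ ∑ (f ∘ suc)           ∎
  where open ≃-Reasoning
∑-≥ f (suc i) a = begin
  ∑ f ≥ (suc i , a)                         ≈⟨ ≥-cong (∑-suc f) (suc i , a) ⟩
  (f 0 ⊕ ∑ (f ∘ suc)) ≥ inj₂ (i , a)        ≈⟨ ⊕-≥₂ (f 0) (∑ (f ∘ suc)) (i , a) ⟩
  ∑ (f ∘ suc) ≥ (i , a)                     ≈⟨ ∑-≥ (f ∘ suc) i a ⟩
  (f (suc i) ≥ a) ⊕ ∑≥ (suc (suc i)) f      ∎
  where open ≃-Reasoning

-- gᵢ₋₁ + ⋯ + g₁ + g₀ + X
prepend : ℕ → (ℕ → Chain ℓ) → Chain ℓ → Chain ℓ
prepend zero    g X = X
prepend (suc i) g X = g i ⊕ prepend i g X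

-- The same sum, with g₀ already attached to X.
prepend-suc : ∀ i (g : ℕ → Chain ℓ) X → prepend i (g ∘ suc) (g 0 ⊕ X) ≃ prepend (suc i) g X
prepend-suc zero    g X = ≃-refl
prepend-suc (suc i) g X = ⊕-cong ≃-refl (prepend-suc i g X)

∑*-≥ : (g : ℕ → Chain ℓ) (X : Chain ℓ) (i : ℕ) (a : ∣ g i ∣) →
       (∑* g ⊕ X) ≥ inj₁ (i , a) ≃ (g i ≥ a) ⊕ prepend i g X
∑*-≥ {ℓ} g X i a = begin
  (∑* g ⊕ X) ≥ inj₁ (i , a)                      ≈⟨ ≥-cong shift (inj₁ (i , a)) ⟩
  (∑* (g ∘ suc) ⊕ (g 0 ⊕ X)) ≥ shifted i a       ≈⟨ step i a ⟩
  (g i ≥ a) ⊕ prepend i g X                      ∎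
  where
  open ≃-Reasoning
  shift : ∑* g ⊕ X ≃ ∑* (g ∘ suc) ⊕ (g 0 ⊕ X)
  shift = ≃-trans (⊕-cong (∑*-suc g) ≃-refl) (⊕-assoc (∑* (g ∘ suc)) (g 0) X)
  shifted : ∀ i → ∣ g i ∣ → ∣ ∑* (g ∘ suc) ⊕ (g 0 ⊕ X) ∣
  shifted i a = to shift (inj₁ (i , a))
  step : ∀ i a → (∑* (g ∘ suc) ⊕ (g 0 ⊕ X)) ≥ shifted i a ≃ (g i ≥ a) ⊕ prepend i g X
  step zero a = begin
    (∑* (g ∘ suc) ⊕ (g 0 ⊕ X)) ≥ inj₂ (inj₁ a) ≈⟨ ⊕-≥₂ (∑* (g ∘ suc)) (g 0 ⊕ X) (inj₁ a) ⟩
    (g 0 ⊕ X) ≥ inj₁ a                         ≈⟨ ⊕-≥₁ (g 0) X a ⟩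
    (g 0 ≥ a) ⊕ X                              ∎
  step (suc i) a = begin
    (∑* (g ∘ suc) ⊕ (g 0 ⊕ X)) ≥ inj₁ (i , a)
      ≈⟨ ∑*-≥ (g ∘ suc) (g 0 ⊕ X) i a ⟩
    (g (suc i) ≥ a) ⊕ prepend i (g ∘ suc) (g 0 ⊕ X)
      ≈⟨ ⊕-cong ≃-refl (prepend-suc i g X) ⟩
    (g (suc i) ≥ a) ⊕ prepend (suc i) g X ∎

-- Successors and condensation

-- y is the immediate successor of x.  The order T is only assumed total, so
-- that T may be one of the quotients A / n.
Successor : (T : TotalOrder ℓ ℓ ℓ) → TotalOrder.Carrier T → TotalOrder.Carrier T → Set ℓ
Successor T x y = x < y × (∀ z → x < z → y ≤ z)
  where
  open TotalOrder T
  open ToStrict _≈_ _≤_ using (_<_)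

NoSuccessors : TotalOrder ℓ ℓ ℓ → Set ℓ
NoSuccessors T = ∀ x y → ¬ Successor T x y

module _ (em : ExcludedMiddle ℓ) where

  module _ (T : TotalOrder ℓ ℓ ℓ) where

    open TotalOrder T using (Carrier; _≈_; _≤_; trans; reflexive; total; module Eq)
      renaming (refl to ≤-refl)
    open ToStrict _≈_ _≤_ using (_<_)
    open Condensation T using (_∼_; _≲_; quotient)

    -- Some m in the interval from x (excluded) to y is a lower bound of the
    -- listed elements above x.
    least-above : ∀ {x y} (zs : List Carrier) → x < y →
                  Σ[ m ∈ Carrier ] x < m × m ≤ y ×
                    (∀ {z} → _∈_ Eq.setoid z zs → x < z → m ≤ z)
    least-above {y = y} [] x<y = y , x<y , ≤-refl , λ ()
    least-above {x} (w ∷ zs) x<y with least-above zs x<y | em {x < w}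
    ... | m , x<m , m≤y , least | no x≮w = m , x<m , m≤y , λ
      { (here z≈w) (x≤z , x≉z) → ⊥-elim (x≮w
          (trans x≤z (reflexive z≈w) , λ x≈w → x≉z (Eq.trans x≈w (Eq.sym z≈w))))
      ; (there z∈zs) x<z → least z∈zs x<z }
    ... | m , x<m , m≤y , least | yes x<w with total m w
    ...   | inj₁ m≤w = m , x<m , m≤y , λ
      { (here z≈w) _ → trans m≤w (reflexive (Eq.sym z≈w))
      ; (there z∈zs) x<z → least z∈zs x<z }
    ...   | inj₂ w≤m = w , x<w , trans w≤m m≤y , λ
      { (here z≈w) _ → reflexive (Eq.sym z≈w)
      ; (there z∈zs) x<z → trans w≤m (least z∈zs x<z) }

    -- The bound m of the previous lemma for a list covering the interval.
    finite⇒successor : ∀ {x y} → x < y → x ∼ y → Σ[ m ∈ Carrier ] Successor T x m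
    finite⇒successor {y = y} x<y (zs , covers) with least-above zs x<y
    ... | m , x<m , m≤y , least = m , x<m , minimal
      where
      minimal : ∀ z → _ < z → m ≤ z
      minimal z x<z with total z y
      ... | inj₁ z≤y = least (covers (inj₁ (proj₁ x<z , z≤y))) x<z
      ... | inj₂ y≤z = trans m≤y y≤z

    module _ (ns : NoSuccessors T) where

      ∼⇒≈ : ∀ {x y} → x ∼ y → x ≈ y
      ∼⇒≈ {x} {y} x∼y with em {x ≈ y} | total x y
      ... | yes x≈y | _ = x≈y
      ... | no x≉y | inj₁ x≤y = ⊥-elim
        (ns _ _ (proj₂ (finite⇒successor (x≤y , x≉y) x∼y)))
      ... | no x≉y | inj₂ y≤x = ⊥-elim
        (ns _ _ (proj₂ (finite⇒successor (y≤x , x≉y ∘ Eq.sym) y∼x)))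
        where y∼x = TotalOrder.Eq.sym quotient x∼y

      -- Condensing then changes neither the order nor the equality.
      quotient-noSuccessors : NoSuccessors quotient
      quotient-noSuccessors x y ((x≲y , x≁y) , minimal) =
        ns x y ((≲⇒≤ x≲y , x≁y ∘ ≈⇒∼) , λ z (x≤z , x≉z) →
          ≲⇒≤ (minimal z (inj₁ x≤z , x≉z ∘ ∼⇒≈)))
        where
        ≲⇒≤ : ∀ {x y} → x ≲ y → x ≤ y
        ≲⇒≤ (inj₁ x≤y) = x≤y
        ≲⇒≤ (inj₂ x∼y) = reflexive (∼⇒≈ x∼y)
        ≈⇒∼ : ∀ {x y} → x ≈ y → x ∼ y
        ≈⇒∼ x≈y = TotalOrder.antisym quotient
          (inj₁ (reflexive x≈y)) (inj₁ (reflexive (Eq.sym x≈y)))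

  module _ (A : Chain ℓ) (ns : NoSuccessors (DecTotalOrder.totalOrder A)) where

    /-noSuccessors : ∀ n → NoSuccessors (A / n)
    /-noSuccessors zero    = ns
    /-noSuccessors (suc n) = quotient-noSuccessors (A / n) (/-noSuccessors n)

    /-trivial : ∀ n → (∀ x y → TotalOrder._≈_ (A / n) x y) → Trivial A
    /-trivial zero    triv = triv
    /-trivial (suc n) triv =
      /-trivial n (λ x y → ∼⇒≈ (A / n) (/-noSuccessors n) (triv x y))

  -- As f A = 1 + (A ≻ x), the second case says that f A ≅ 1 + f A.
  uniform-dichotomy : (A : Chain ℓ) → Uniform A → ∀ {r} → HasRank A r →
                      (x : ∣ A ∣) → Trivial A ⊎ A ≻ x ≃ A ≥ x
  uniform-dichotomy A unif {r} ((_ , collapse) , _) x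
    with em {Σ[ y ∈ ∣ A ∣ ] Successor (DecTotalOrder.totalOrder A) x y}
  ... | yes (y , (x≤y , x≉y) , minimal) = inj₂ (≃-trans above (≅⇒≃ (unif y x)))
    where
    module A = DecTotalOrder A
    -- y is the least element above x.
    above : A ≻ x ≃ A ≥ y
    above = record
      { to        = λ (z , x<z) → z , minimal z x<z
      ; from      = λ (z , y≤z) → z , A.trans x≤y y≤z , λ x≈z →
          x≉y (A.antisym x≤y (A.trans y≤z (A.reflexive (A.Eq.sym x≈z))))
      ; to-mono   = id
      ; from-mono = id
      ; to∘from   = λ _ → A.Eq.refl
      ; from∘to   = λ _ → A.Eq.refl }
  ... | no none = inj₁ (/-trivial A ns r (λ _ _ → IsOrderIsomorphism.injective collapse refl))
    where
    module A = DecTotalOrder A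
    -- The segments strictly above u and x are isomorphic, and a successor is
    -- a least element of such a segment.
    ns : NoSuccessors A.totalOrder
    ns u v (u<v , minimal) = none (proj₁ v′ , proj₂ v′ , λ z x<z →
      A.trans (to-mono φ {v , u<v} {from φ (z , x<z)} (minimal _ (proj₂ (from φ (z , x<z)))))
              (A.reflexive (to∘from φ (z , x<z))))
      where
      φ : A ≻ u ≃ A ≻ x
      φ = ≥⇒≻ A A u x (≅⇒≃ (unif u x))
      v′ = to φ (v , u<v)

-- Absorption into an infinite sum

-- Two ways in which the i-th members of sequences P and f of chains can be
-- related: f i absorbs a copy of P i put before it, or f i is just a copy of
-- P i and P does not change at the step from i.
Absorbs Stationary : (P f : ℕ → Chain ℓ) → ℕ → Set ℓ
Absorbs    P f i = P i ⊕ f i ≃ f i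
Stationary P f i = f i ≃ P i × P (suc i) ≃ P i

-- All the summands are copies of P 0.
absorb-stationary : (P f : ℕ → Chain ℓ) → (∀ i → Stationary P f i) → P 0 ⊕ ∑ f ≃ ∑ f
absorb-stationary P f st = begin
  P 0 ⊕ ∑ f               ≈⟨ ⊕-cong ≃-refl constant ⟩
  P 0 ⊕ ∑ (λ _ → P 0)     ≈⟨ ∑-suc (λ _ → P 0) ⟨
  ∑ (λ _ → P 0)           ≈⟨ constant ⟨
  ∑ f                     ∎
  where
  open ≃-Reasoning
  P-constant : ∀ i → P i ≃ P 0
  P-constant zero    = ≃-refl
  P-constant (suc i) = ≃-trans (proj₂ (st i)) (P-constant i)
  constant : ∑ f ≃ ∑ (λ _ → P 0)
  constant = ∑-cong f (λ _ → P 0) (λ i → ≃-trans (proj₁ (st i)) (P-constant i))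

absorb-head : (P f : ℕ → Chain ℓ) → Absorbs P f 0 → P 0 ⊕ ∑ f ≃ ∑ f
absorb-head P f abs = begin
  P 0 ⊕ ∑ f                     ≈⟨ ⊕-cong ≃-refl (∑-suc f) ⟩
  P 0 ⊕ (f 0 ⊕ ∑ (f ∘ suc))     ≈⟨ ⊕-assoc (P 0) (f 0) (∑ (f ∘ suc)) ⟨
  P 0 ⊕ f 0 ⊕ ∑ (f ∘ suc)       ≈⟨ ⊕-cong abs ≃-refl ⟩
  f 0 ⊕ ∑ (f ∘ suc)             ≈⟨ ∑-suc f ⟨
  ∑ f                           ∎
  where open ≃-Reasoning

-- By induction on i: a summand on which P is stationary is a copy of P 0, and
-- is itself absorbed by the sum of the later ones.
absorb-at : (P f : ℕ → Chain ℓ) → (∀ i → Absorbs P f i ⊎ Stationary P f i) →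
            ∀ i → Absorbs P f i → P 0 ⊕ ∑ f ≃ ∑ f
absorb-at P f cases zero    abs = absorb-head P f abs
absorb-at P f cases (suc i) abs with cases 0
... | inj₁ abs₀            = absorb-head P f abs₀
... | inj₂ (f₀≃P₀ , P₁≃P₀) = begin
  P 0 ⊕ ∑ f                     ≈⟨ ⊕-cong (≃-sym P₁≃P₀) (∑-suc f) ⟩
  P 1 ⊕ (f 0 ⊕ ∑ (f ∘ suc))     ≈⟨ ⊕-cong ≃-refl (⊕-cong f₀≃P₁ ≃-refl) ⟩
  P 1 ⊕ (P 1 ⊕ ∑ (f ∘ suc))     ≈⟨ ⊕-cong ≃-refl rest ⟩
  P 1 ⊕ ∑ (f ∘ suc)             ≈⟨ ⊕-cong f₀≃P₁ ≃-refl ⟨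
  f 0 ⊕ ∑ (f ∘ suc)             ≈⟨ ∑-suc f ⟨
  ∑ f                           ∎
  where
  open ≃-Reasoning
  f₀≃P₁ = ≃-trans f₀≃P₀ (≃-sym P₁≃P₀)
  rest : P 1 ⊕ ∑ (f ∘ suc) ≃ ∑ (f ∘ suc)
  rest = absorb-at (P ∘ suc) (f ∘ suc) (cases ∘ suc) i abs

-- Excluded middle decides whether some summand absorbs.
absorb : ExcludedMiddle ℓ → (P f : ℕ → Chain ℓ) →
         (∀ i → Absorbs P f i ⊎ Stationary P f i) → ∀ i → P i ⊕ ∑≥ i f ≃ ∑≥ i f
absorb em P f cases (suc i) = absorb em (P ∘ suc) (f ∘ suc) (cases ∘ suc) i
absorb em P f cases zero with em {Σ[ i ∈ ℕ ] Absorbs P f i}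
... | yes (i , abs) = absorb-at P f cases i abs
... | no none       = absorb-stationary P f (λ i → stationary i (cases i))
  where
  stationary : ∀ i → Absorbs P f i ⊎ Stationary P f i → Stationary P f i
  stationary i (inj₁ abs) = ⊥-elim (none (i , abs))
  stationary i (inj₂ st)  = st

-- The infinite uniform chain product

⊕-empty : (A B : Chain ℓ) → ¬ ∣ A ∣ → A ⊕ B ≃ B
⊕-empty A B empty = record
  { to        = λ { (inj₁ a) → ⊥-elim (empty a) ; (inj₂ b) → b }
  ; from      = inj₂
  ; to-mono   = λ { {inj₁ a} _ → ⊥-elim (empty a) ; (₂∼₂ p) → p }
  ; from-mono = ₂∼₂
  ; to∘from   = λ _ → DecTotalOrder.Eq.refl B
  ; from∘to   = λ { (inj₁ a) → ⊥-elim (empty a) ; (inj₂ b) → inj₂ (DecTotalOrder.Eq.refl B) } }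

𝟙-≥ : (x : ∣ 𝟙 {ℓ} ∣) → 𝟙 {ℓ} ≥ x ≃ 𝟙 {ℓ}
𝟙-≥ x = record
  { to = λ _ → tt ; from = λ _ → tt , refl ; to-mono = λ _ → refl ; from-mono = λ _ → refl
  ; to∘from = λ _ → refl ; from∘to = λ _ → refl }

module Product (em : ExcludedMiddle ℓ) (H : ℕ → Chain ℓ) (unif : ∀ i → Uniform (H i))
               (r : ℕ → ℕ) (rank : ∀ i → HasRank (H i) (r i)) (x : ∀ i → ∣ H i ∣) where

  open ≃-Reasoning

  -- The partial products, the parts of the factors strictly above the chosen
  -- points, the summands of the positive and of the negative half of the
  -- product, and the final sums of the positive half.
  P G f g S : ℕ → Chain ℓ
  P = ∏< H
  G i = H i ≻ x i
  f i = P i ∙ (H i ≥ x i)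
  g i = P i ∙ 𝐣 (H i) (x i)
  S i = ∑≥ i f

  dichotomy : ∀ i → Trivial (H i) ⊎ G i ≃ H i ≥ x i
  dichotomy i = uniform-dichotomy em (H i) (unif i) (rank i) (x i)

  trivial⇒stationary : ∀ i → Trivial (H i) → Stationary P f i
  trivial⇒stationary i triv =
    ∙-trivial (P i) (H i ≥ x i) (λ y z → triv (proj₁ y) (proj₁ z)) (x i , refl-x) ,
    ∙-trivial (P i) (H i) triv (x i)
    where refl-x = DecTotalOrder.refl (H i)

  nontrivial⇒absorbs : ∀ i → G i ≃ H i ≥ x i → Absorbs P f i
  nontrivial⇒absorbs i G≃fH = begin
    P i ⊕ f i           ≈⟨ ⊕-cong ≃-refl (∙-cong (P i) G≃fH) ⟨
    P i ⊕ P i ∙ G i     ≈⟨ ∙-cut-≥ (P i) (H i) (x i) ⟨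
    f i                 ∎

  cases : ∀ i → Absorbs P f i ⊎ Stationary P f i
  cases i with dichotomy i
  ... | inj₁ triv = inj₂ (trivial⇒stationary i triv)
  ... | inj₂ G≃fH  = inj₁ (nontrivial⇒absorbs i G≃fH)

  S-absorbs : ∀ i → P i ⊕ S i ≃ S i
  S-absorbs = absorb em P f cases

  S-suc : ∀ i → P i ∙ G i ⊕ S (suc i) ≃ S i
  S-suc i with dichotomy i
  ... | inj₂ G≃fH = begin
    P i ∙ G i ⊕ S (suc i)     ≈⟨ ⊕-cong (∙-cong (P i) G≃fH) ≃-refl ⟩
    f i ⊕ S (suc i)           ≈⟨ ∑≥-suc i f ⟨
    S i                       ∎
  ... | inj₁ triv = begin
    P i ∙ G i ⊕ S (suc i)     ≈⟨ ⊕-empty (P i ∙ G i) (S (suc i)) empty ⟩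
    S (suc i)                 ≈⟨ S-absorbs (suc i) ⟨
    P (suc i) ⊕ S (suc i)     ≈⟨ ⊕-cong (≃-trans P′≃P (≃-sym f≃P)) ≃-refl ⟩
    f i ⊕ S (suc i)           ≈⟨ ∑≥-suc i f ⟨
    S i                       ∎
    where
    f≃P  = proj₁ (trivial⇒stationary i triv)
    P′≃P = proj₂ (trivial⇒stationary i triv)
    empty : ¬ ∣ P i ∙ G i ∣
    empty ((y , _ , x≉y) , _) = x≉y (triv (x i) y)

  -- For i = 0 this is 1 + S₀ ≅ S₀.
  P-tail : ∀ i (p : ∣ P i ∣) → (P i ≥ p) ⊕ S i ≃ S 0
  P-tail zero p = begin
    (𝟙 ≥ p) ⊕ S 0     ≈⟨ ⊕-cong (𝟙-≥ p) ≃-refl ⟩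
    𝟙 ⊕ S 0           ≈⟨ S-absorbs 0 ⟩
    S 0               ∎
  P-tail (suc i) (h , p) = begin
    (P (suc i) ≥ (h , p)) ⊕ S (suc i)
      ≈⟨ ⊕-cong (∙-≥ (P i) (H i) h p) ≃-refl ⟩
    (P i ≥ p) ⊕ P i ∙ (H i ≻ h) ⊕ S (suc i)
      ≈⟨ ⊕-cong (⊕-cong ≃-refl (∙-cong (P i) H≻h≃G)) ≃-refl ⟩
    (P i ≥ p) ⊕ P i ∙ G i ⊕ S (suc i)
      ≈⟨ ⊕-assoc (P i ≥ p) (P i ∙ G i) (S (suc i)) ⟩
    (P i ≥ p) ⊕ (P i ∙ G i ⊕ S (suc i))
      ≈⟨ ⊕-cong ≃-refl (S-suc i) ⟩
    (P i ≥ p) ⊕ S i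
      ≈⟨ P-tail i p ⟩
    S 0 ∎
    where
    H≻h≃G : H i ≻ h ≃ G i
    H≻h≃G = ≥⇒≻ (H i) (H i) h (x i) (≅⇒≃ (unif i h (x i)))

  glue : ∀ i → g i ⊕ (P i ⊕ S i) ≃ P (suc i) ⊕ S (suc i)
  glue i = begin
    g i ⊕ (P i ⊕ S i)
      ≈⟨ ⊕-cong ≃-refl (⊕-cong ≃-refl (S-suc i)) ⟨
    g i ⊕ (P i ⊕ (P i ∙ G i ⊕ S (suc i)))
      ≈⟨ ⊕-cong ≃-refl (⊕-assoc (P i) (P i ∙ G i) (S (suc i))) ⟨
    g i ⊕ (P i ⊕ P i ∙ G i ⊕ S (suc i))
      ≈⟨ ⊕-assoc (g i) (P i ⊕ P i ∙ G i) (S (suc i)) ⟨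
    g i ⊕ (P i ⊕ P i ∙ G i) ⊕ S (suc i)
      ≈⟨ ⊕-cong (∙-cut (P i) (H i) (x i)) ≃-refl ⟩
    P (suc i) ⊕ S (suc i) ∎

  -- Everything after the summand g i of the negative half.
  prepend≃ : ∀ i → prepend i g (S 0) ≃ P i ⊕ S i
  prepend≃ zero    = ≃-sym (S-absorbs 0)
  prepend≃ (suc i) = ≃-trans (⊕-cong ≃-refl (prepend≃ i)) (glue i)

  -- The point (h , p) of g i is followed from g i to P (suc i) by glue, whose
  -- map acts on it as the inclusion.
  ∏∞-tail : ∀ z → ∏∞ H unif x ≥ z ≃ S 0
  ∏∞-tail (inj₁ (i , (h , p))) = begin
    ∏∞ H unif x ≥ inj₁ (i , (h , p))
      ≈⟨ ∑*-≥ g (S 0) i (h , p) ⟩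
    (g i ≥ (h , p)) ⊕ prepend i g (S 0)
      ≈⟨ ⊕-cong ≃-refl (prepend≃ i) ⟩
    (g i ≥ (h , p)) ⊕ (P i ⊕ S i)
      ≈⟨ ⊕-≥₁ (g i) (P i ⊕ S i) (h , p) ⟨
    (g i ⊕ (P i ⊕ S i)) ≥ inj₁ (h , p)
      ≈⟨ ≥-cong (glue i) (inj₁ (h , p)) ⟩
    (P (suc i) ⊕ S (suc i)) ≥ inj₁ (proj₁ h , p)
      ≈⟨ ⊕-≥₁ (P (suc i)) (S (suc i)) (proj₁ h , p) ⟩
    (P (suc i) ≥ (proj₁ h , p)) ⊕ S (suc i)
      ≈⟨ P-tail (suc i) (proj₁ h , p) ⟩
    S 0 ∎
  ∏∞-tail (inj₂ (i , (h , p))) = begin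
    ∏∞ H unif x ≥ inj₂ (i , (h , p))
      ≈⟨ ⊕-≥₂ (∑* g) (S 0) (i , (h , p)) ⟩
    ∑ f ≥ (i , (h , p))
      ≈⟨ ∑-≥ f i (h , p) ⟩
    (f i ≥ (h , p)) ⊕ S (suc i)
      ≈⟨ ⊕-cong (∙-≥-≥ (P i) (H i) (x i) h p) ≃-refl ⟩
    (P (suc i) ≥ (proj₁ h , p)) ⊕ S (suc i)
      ≈⟨ P-tail (suc i) (proj₁ h , p) ⟩
    S 0 ∎

mainTheorem4 : ∀ {ℓ} → ExcludedMiddle ℓ →
    (H : ℕ → Chain ℓ) (unif : ∀ i → Uniform (H i))
    (r : ℕ → ℕ) → (∀ i → HasRank (H i) (r i)) →
    (x : ∀ i → ∣ H i ∣) → (∀ i → CanonicalZero (H i) (r i) (x i)) →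
    Σ[ u ∈ Uniform (∏∞ H unif x) ]
    (∀ z → 𝐟 (∏∞ H unif x) u z ≅ ∑ (λ i → ∏< H i ∙ 𝐟 (H i) (unif i) (x i)))
mainTheorem4 em H unif r rank x _ =
  (λ y z → ≃⇒≅ (≃-trans (∏∞-tail y) (≃-sym (∏∞-tail z)))) ,
  (λ z → ≃⇒≅ (∏∞-tail z))
  where open Product em H unif r rank x
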